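{- Let $h$ be a Hessenberg function on $\{1,\dots,n\}$ with degree tuple $(\beta_n,\dots,\beta_1)$, and let $R=\mathbb{Z}[x_1,\dots,x_n]$. Then $R/J_h$ is a free $\mathbb{Z}$-module with basis (the images of) the monomials $$\mathcal{B}_h=\{x_1^{\alpha_1}x_2^{\alpha_2}\cdots x_n^{\alpha_n} : 0\le\alpha_i\le\beta_i-1,\ i=1,\dots,n\}.$$
   Context: A Hessenberg function is a map $h:\{1,\dots,n\}\to\{1,\dots,n\}$, $h_i:=h(i)$, with $i\le h_i\le n$ for all $i$ and $h_i\le h_{i+1}$ for $1\le i\le n-1$. Its degree tuple is $(\beta_n,\beta_{n-1},\dots,\beta_1)$ with $\beta_i=i-\#\{k: h_k<i\}$. For a set $S$ of variables, $\tilde e_r(S)$ denotes the complete homogeneous symmetric polynomial of degree $r$ in $S$ (sum of all degree-$r$ monomials in $S$, e.g. $\tilde e_2(x_3,x_4)=x_3^2+x_3x_4+x_4^2$). The ideal is $J_h=\langle \tilde e_{\beta_n}(x_n),\tilde e_{\beta_{n-1}}(x_{n-1},x_n),\dots,\tilde e_{\beta_1}(x_1,\dots,x_n)\rangle\subseteq R$, i.e. the $i$-th generator is $\tilde e_{\beta_i}(x_i,x_{i+1},\dots,x_n)$. -}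

module Defs where

open import Algebra.Bundles using (CommutativeRing)
open import Algebra.Module.Bundles using (Module)
open import Algebra.Module.Structures.Biased using (IsModuleFromLeft)
open import Algebra.Morphism.Structures using (module RingMorphisms)
import Algebra.Properties.AbelianGroup as AbelianGroupProperties
import Algebra.Properties.CommutativeSemigroup as CommutativeSemigroupProperties
import Algebra.Properties.Ring as RingProperties
import Algebra.Properties.Semiring.Sum as SemiringSum
open import Data.Bool.Base using (true; false; if_then_else_)
open import Data.Fin.Base as Fin using (Fin; toℕ)
import Data.Fin.Properties as Fin
open import Data.Fin.Subset using (Subset; inside; outside)
open import Data.Integer.Base as ℤ using (ℤ; 0ℤ; 1ℤ)
import Data.Integer.Properties as ℤ
open import Data.List.Base as List using (List; []; _∷_; _++_; concatMap; cartesianProductWith; upTo)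
open import Data.List.Relation.Unary.All using (All)
open import Data.List.Relation.Unary.Unique.Propositional using (Unique)
open import Data.Nat.Base as ℕ using (ℕ; zero; suc; _∸_)
import Data.Nat.Properties as ℕ
open import Data.Product.Base using (_×_; _,_; proj₂; Σ-syntax; ∃-syntax)
open import Data.Vec.Base as Vec using (Vec; []; _∷_; lookup; replicate; zipWith; count; allFin; tabulate)
import Data.Vec.Functional as Functional
import Data.Vec.Properties as Vec
open import Level using (_⊔_; 0ℓ)
open import Relation.Binary.PropositionalEquality as ≡ using (_≡_; module ≡-Reasoning)
open import Relation.Nullary.Decidable using (Dec; yes; no; does)

private
  variable
    n : ℕ

module _ {r ℓr m ℓm} {S : CommutativeRing r ℓr} (M : Module S m ℓm) where

  open CommutativeRing S using (_≈_; 0#) renaming (Carrier to Scalar)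
  open Module M

  linearCombination : ∀ {i} {I : Set i} → (I → Carrierᴹ) → List (Scalar × I) → Carrierᴹ
  linearCombination b []            = 0ᴹ
  linearCombination b ((c , i) ∷ t) = c *ₗ b i +ᴹ linearCombination b t

  record IsBasis {i} {I : Set i} (b : I → Carrierᴹ) : Set (r ⊔ ℓr ⊔ m ⊔ ℓm ⊔ i) where
    field
      spanning    : ∀ x → ∃[ t ] x ≈ᴹ linearCombination b t
      independent : ∀ t → Unique (List.map proj₂ t) →
                    linearCombination b t ≈ᴹ 0ᴹ →
                    All (λ (c , _) → c ≈ 0#) t

module _ {c ℓ} (R : CommutativeRing c ℓ) {k : ℕ} where

  open CommutativeRing R
  open SemiringSum semiring using (sum; sum-cong-≋; sum-replicate-zero; ∑-distrib-+; *-distribˡ-sum)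
  open AbelianGroupProperties +-abelianGroup using (⁻¹-anti-homo‿-; ⁻¹-∙-comm; x≈y⇒x∙y⁻¹≈ε)
  open RingProperties ring using (-1*x≈-x; x[y-z]≈xy-xz; [y-z]x≈yx-zx)
  open CommutativeSemigroupProperties +-commutativeSemigroup using (interchange)
  open import Relation.Binary.Reasoning.Setoid setoid

  infix 4 _∈⟨_⟩

  _∈⟨_⟩ : Carrier → Functional.Vector Carrier k → Set (c ⊔ ℓ)
  x ∈⟨ g ⟩ = Σ[ a ∈ Functional.Vector Carrier k ] x ≈ sum (λ i → a i * g i)

  -- Congruence modulo ⟨ g ⟩.  A record, so that x and y can be inferred.
  record Congruent (g : Functional.Vector Carrier k) (x y : Carrier) : Set (c ⊔ ℓ) where
    constructor congruent
    field difference : x - y ∈⟨ g ⟩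

  module _ (g : Functional.Vector Carrier k) where

    ∈-resp-≈ : ∀ {x y} → x ≈ y → x ∈⟨ g ⟩ → y ∈⟨ g ⟩
    ∈-resp-≈ x≈y (a , eq) = a , trans (sym x≈y) eq

    ∈-0# : 0# ∈⟨ g ⟩
    ∈-0# = (λ _ → 0#) , sym (trans (sum-cong-≋ (λ i → zeroˡ (g i))) (sum-replicate-zero k))

    ∈-+ : ∀ {x y} → x ∈⟨ g ⟩ → y ∈⟨ g ⟩ → x + y ∈⟨ g ⟩
    ∈-+ {x} {y} (a , p) (b , q) = (λ i → a i + b i) , (begin
      x + y                                          ≈⟨ +-cong p q ⟩
      sum (λ i → a i * g i) + sum (λ i → b i * g i)  ≈⟨ ∑-distrib-+ (λ i → a i * g i) (λ i → b i * g i) ⟨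
      sum (λ i → a i * g i + b i * g i)              ≈⟨ sum-cong-≋ (λ i → distribʳ (g i) (a i) (b i)) ⟨
      sum (λ i → (a i + b i) * g i)                  ∎)

    ∈-* : ∀ z {x} → x ∈⟨ g ⟩ → z * x ∈⟨ g ⟩
    ∈-* z {x} (a , p) = (λ i → z * a i) , (begin
      z * x                          ≈⟨ *-congˡ p ⟩
      z * sum (λ i → a i * g i)      ≈⟨ *-distribˡ-sum z (λ i → a i * g i) ⟩
      sum (λ i → z * (a i * g i))    ≈⟨ sum-cong-≋ (λ i → *-assoc z (a i) (g i)) ⟨
      sum (λ i → (z * a i) * g i)    ∎)

    ∈-neg : ∀ {x} → x ∈⟨ g ⟩ → - x ∈⟨ g ⟩
    ∈-neg {x} p = ∈-resp-≈ (-1*x≈-x x) (∈-* (- 1#) p)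

    telescope : ∀ x y z → (x - y) + (y - z) ≈ x - z
    telescope x y z = begin
      (x - y) + (y - z)      ≈⟨ +-assoc x (- y) (y - z) ⟩
      x + (- y + (y - z))    ≈⟨ +-congˡ (+-assoc (- y) y (- z)) ⟨
      x + ((- y + y) - z)    ≈⟨ +-congˡ (+-congʳ (-‿inverseˡ y)) ⟩
      x + (0# - z)           ≈⟨ +-congˡ (+-identityˡ (- z)) ⟩
      x - z                  ∎

    ≈⇒congruent : ∀ {x y} → x ≈ y → Congruent g x y
    ≈⇒congruent x≈y = congruent (∈-resp-≈ (sym (x≈y⇒x∙y⁻¹≈ε x≈y)) ∈-0#)

    congruent-sym : ∀ {x y} → Congruent g x y → Congruent g y x
    congruent-sym {x} {y} (congruent p) = congruent (∈-resp-≈ (⁻¹-anti-homo‿- x y) (∈-neg p))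

    congruent-trans : ∀ {x y z} → Congruent g x y → Congruent g y z → Congruent g x z
    congruent-trans {x} {y} {z} (congruent p) (congruent q) =
      congruent (∈-resp-≈ (telescope x y z) (∈-+ p q))

    +-congruent : ∀ {x y u v} → Congruent g x y → Congruent g u v → Congruent g (x + u) (y + v)
    +-congruent {x} {y} {u} {v} (congruent p) (congruent q) = congruent (∈-resp-≈
      (trans (interchange x (- y) u (- v)) (+-congˡ (⁻¹-∙-comm y v))) (∈-+ p q))

    *-congruent : ∀ {x y u v} → Congruent g x y → Congruent g u v → Congruent g (x * u) (y * v)
    *-congruent {x} {y} {u} {v} (congruent p) (congruent q) = congruent (∈-resp-≈
      (begin
        u * (x - y) + y * (u - v)              ≈⟨ +-congʳ (*-comm u (x - y)) ⟩
        (x - y) * u + y * (u - v)              ≈⟨ +-cong ([y-z]x≈yx-zx u x y) (x[y-z]≈xy-xz y u v) ⟩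
        (x * u - y * u) + (y * u - y * v)      ≈⟨ telescope (x * u) (y * u) (y * v) ⟩
        x * u - y * v                          ∎)
      (∈-+ (∈-* u p) (∈-* y q)))

    -‿congruent : ∀ {x y} → Congruent g x y → Congruent g (- x) (- y)
    -‿congruent {x} {y} (congruent p) = congruent (∈-resp-≈ (sym (⁻¹-∙-comm x (- y))) (∈-neg p))

infix 8 _/⟨_⟩

_/⟨_⟩ : ∀ {c ℓ} (R : CommutativeRing c ℓ) {k} →
        Functional.Vector (CommutativeRing.Carrier R) k → CommutativeRing c (c ⊔ ℓ)
R /⟨ g ⟩ = record
  { Carrier = Carrier
  ; _≈_     = Congruent R g
  ; _+_     = _+_
  ; _*_     = _*_
  ; -_      = -_
  ; 0#      = 0#
  ; 1#      = 1#
  ; isCommutativeRing = record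
    { isRing = record
      { +-isAbelianGroup = record
        { isGroup = record
          { isMonoid = record
            { isSemigroup = record
              { isMagma = record
                { isEquivalence = record
                  { refl  = up refl′
                  ; sym   = congruent-sym R g
                  ; trans = congruent-trans R g
                  }
                ; ∙-cong = +-congruent R g
                }
              ; assoc = λ x y z → up (+-assoc x y z)
              }
            ; identity = (λ x → up (+-identityˡ x)) , (λ x → up (+-identityʳ x))
            }
          ; inverse = (λ x → up (-‿inverseˡ x)) , (λ x → up (-‿inverseʳ x))
          ; ⁻¹-cong = -‿congruent R g
          }
        ; comm = λ x y → up (+-comm x y)
        }
      ; *-cong     = *-congruent R g
      ; *-assoc    = λ x y z → up (*-assoc x y z)
      ; *-identity = (λ x → up (*-identityˡ x)) , (λ x → up (*-identityʳ x))
      ; distrib    = (λ x y z → up (distribˡ x y z)) , (λ x y z → up (distribʳ x y z))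
      }
    ; *-comm = λ x y → up (*-comm x y)
    }
  }
  where
  open CommutativeRing R renaming (refl to refl′)
  up : ∀ {x y} → x ≈ y → Congruent R g x y
  up = ≈⇒congruent R g

-- A commutative ring A with a ring homomorphism ι : S → A, as an S-module.

module _ {r ℓr a ℓa} (S : CommutativeRing r ℓr) (A : CommutativeRing a ℓa) where

  private
    module S = CommutativeRing S
    module A = CommutativeRing A

  open RingMorphisms S.rawRing A.rawRing using (IsRingHomomorphism)

  algebraModule : (ι : S.Carrier → A.Carrier) → IsRingHomomorphism ι → Module S a ℓa
  algebraModule ι ι-hom = record
    { Carrierᴹ = A.Carrier
    ; _≈ᴹ_     = A._≈_
    ; _+ᴹ_     = A._+_
    ; _*ₗ_     = λ s x → ι s A.* x
    ; _*ᵣ_     = λ x s → ι s A.* x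
    ; 0ᴹ       = A.0#
    ; -ᴹ_      = A.-_
    ; isModule = IsModuleFromLeft.isModule {commutativeRing = S} (record
      { isLeftModule = record
        { isLeftSemimodule = record
          { +ᴹ-isCommutativeMonoid = A.+-isCommutativeMonoid
          ; isPreleftSemimodule = record
            { *ₗ-cong      = λ p q → A.*-cong (⟦⟧-cong p) q
            ; *ₗ-zeroˡ     = λ x → A.trans (A.*-congʳ 0#-homo) (A.zeroˡ x)
            ; *ₗ-distribʳ  = λ x s t → A.trans (A.*-congʳ (+-homo s t)) (A.distribʳ x (ι s) (ι t))
            ; *ₗ-identityˡ = λ x → A.trans (A.*-congʳ 1#-homo) (A.*-identityˡ x)
            ; *ₗ-assoc     = λ s t x → A.trans (A.*-congʳ (*-homo s t)) (A.*-assoc (ι s) (ι t) x)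
            ; *ₗ-zeroʳ     = λ s → A.zeroʳ (ι s)
            ; *ₗ-distribˡ  = λ s x y → A.distribˡ (ι s) x y
            }
          }
        ; -ᴹ‿cong    = A.-‿cong
        ; -ᴹ‿inverse = A.-‿inverse
        }
      })
    }
    where open IsRingHomomorphism ι-hom

open ≡ using (refl; sym; trans; cong; cong₂)

-- α stands for the monomial x₁^α₁ ⋯ xₙ^αₙ.
Exponents : ℕ → Set
Exponents = Vec ℕ

_⊕_ : Exponents n → Exponents n → Exponents n
_⊕_ = zipWith ℕ._+_

-- A polynomial is a formal sum of terms c·x^α.  Exponents may repeat and
-- coefficients may vanish; polynomials are compared by their coefficients.
Poly : ℕ → Set
Poly n = List (ℤ × Exponents n)

_≟ᴱ_ : (α γ : Exponents n) → Dec (α ≡ γ)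
_≟ᴱ_ = Vec.≡-dec ℕ._≟_

coeff : Poly n → Exponents n → ℤ
coeff []            γ = 0ℤ
coeff ((c , α) ∷ f) γ = (if does (α ≟ᴱ γ) then c else 0ℤ) ℤ.+ coeff f γ

infix 4 _≈ₚ_

record _≈ₚ_ (f g : Poly n) : Set where
  constructor coeffwise
  field coeff-≡ : ∀ γ → coeff f γ ≡ coeff g γ
open _≈ₚ_ public

constant : ℤ → Poly n
constant c = (c , replicate _ 0) ∷ []

monomial : Exponents n → Poly n
monomial α = (1ℤ , α) ∷ []

infixl 6 _+ₚ_
infixl 7 _*ₚ_
infix  8 -ₚ_

_+ₚ_ : Poly n → Poly n → Poly n
_+ₚ_ = _++_

-ₚ_ : Poly n → Poly n
-ₚ_ = List.map (λ (c , α) → ℤ.- c , α)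

_*ₚ_ : Poly n → Poly n → Poly n
_*ₚ_ = cartesianProductWith (λ (c , α) (d , β) → c ℤ.* d , α ⊕ β)

0ₚ 1ₚ : Poly n
0ₚ = []
1ₚ = constant 1ℤ

-- The additive extension of φ to polynomials; extracting the coefficient of
-- x^γ is the case φ = δ γ (coeff≡eval), which reduces the ring laws to ℤ.
eval : (Exponents n → ℤ) → Poly n → ℤ
eval φ []            = 0ℤ
eval φ ((c , α) ∷ f) = c ℤ.* φ α ℤ.+ eval φ f

δ : Exponents n → Exponents n → ℤ
δ γ α = if does (α ≟ᴱ γ) then 1ℤ else 0ℤ

private
  open ≡-Reasoning
  module ℤ+-Properties = CommutativeSemigroupProperties ℤ.+-commutativeSemigroup
  module ℤ*-Properties = CommutativeSemigroupProperties ℤ.*-commutativeSemigroup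

coeff≡eval : (f : Poly n) (γ : Exponents n) → coeff f γ ≡ eval (δ γ) f
coeff≡eval []            γ = refl
coeff≡eval ((c , α) ∷ f) γ = cong₂ ℤ._+_ (lemma (does (α ≟ᴱ γ))) (coeff≡eval f γ)
  where
  lemma : ∀ b → (if b then c else 0ℤ) ≡ c ℤ.* (if b then 1ℤ else 0ℤ)
  lemma true  = sym (ℤ.*-identityʳ c)
  lemma false = sym (ℤ.*-zeroʳ c)

eval-cong : {φ ψ : Exponents n → ℤ} → (∀ α → φ α ≡ ψ α) → ∀ f → eval φ f ≡ eval ψ f
eval-cong p []            = refl
eval-cong p ((c , α) ∷ f) = cong₂ ℤ._+_ (cong (c ℤ.*_) (p α)) (eval-cong p f)

eval-++ : (φ : Exponents n → ℤ) (f g : Poly n) → eval φ (f +ₚ g) ≡ eval φ f ℤ.+ eval φ g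
eval-++ φ []            g = sym (ℤ.+-identityˡ _)
eval-++ φ ((c , α) ∷ f) g = trans (cong (ℤ._+_ (c ℤ.* φ α)) (eval-++ φ f g)) (sym (ℤ.+-assoc (c ℤ.* φ α) _ _))

eval-neg : (φ : Exponents n → ℤ) (f : Poly n) → eval φ (-ₚ f) ≡ ℤ.- eval φ f
eval-neg φ []            = refl
eval-neg φ ((c , α) ∷ f) = trans
  (cong₂ ℤ._+_ (sym (ℤ.neg-distribˡ-* c (φ α))) (eval-neg φ f))
  (sym (ℤ.neg-distrib-+ (c ℤ.* φ α) (eval φ f)))

eval-zero : (f : Poly n) → eval (λ _ → 0ℤ) f ≡ 0ℤ
eval-zero []            = refl
eval-zero ((c , α) ∷ f) = cong₂ ℤ._+_ (ℤ.*-zeroʳ c) (eval-zero f)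

eval-scale : (c : ℤ) (φ : Exponents n → ℤ) (f : Poly n) → eval (λ α → c ℤ.* φ α) f ≡ c ℤ.* eval φ f
eval-scale c φ []            = sym (ℤ.*-zeroʳ c)
eval-scale c φ ((d , α) ∷ f) = trans
  (cong₂ ℤ._+_ (ℤ*-Properties.x∙yz≈y∙xz d c (φ α)) (eval-scale c φ f))
  (sym (ℤ.*-distribˡ-+ c (d ℤ.* φ α) (eval φ f)))

eval-add : (φ ψ : Exponents n → ℤ) (f : Poly n) →
           eval (λ α → φ α ℤ.+ ψ α) f ≡ eval φ f ℤ.+ eval ψ f
eval-add φ ψ []            = refl
eval-add φ ψ ((c , α) ∷ f) = trans
  (cong₂ ℤ._+_ (ℤ.*-distribˡ-+ c (φ α) (ψ α)) (eval-add φ ψ f))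
  (ℤ+-Properties.interchange (c ℤ.* φ α) (c ℤ.* ψ α) (eval φ f) (eval ψ f))

eval-swap : (φ : Exponents n → Exponents n → ℤ) (f g : Poly n) →
            eval (λ α → eval (φ α) g) f ≡ eval (λ β → eval (λ α → φ α β) f) g
eval-swap φ []            g = sym (eval-zero g)
eval-swap φ ((c , α) ∷ f) g = begin
  c ℤ.* eval (φ α) g ℤ.+ eval (λ α → eval (φ α) g) f
    ≡⟨ cong₂ ℤ._+_ (sym (eval-scale c (φ α) g)) (eval-swap φ f g) ⟩
  eval (λ β → c ℤ.* φ α β) g ℤ.+ eval (λ β → eval (λ α → φ α β) f) g
    ≡⟨ eval-add (λ β → c ℤ.* φ α β) (λ β → eval (λ α → φ α β) f) g ⟨
  eval (λ β → c ℤ.* φ α β ℤ.+ eval (λ α → φ α β) f) g ∎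

eval-term-* : (φ : Exponents n → ℤ) (c : ℤ) (α : Exponents n) (g : Poly n) →
              eval φ (List.map (λ (d , β) → c ℤ.* d , α ⊕ β) g) ≡ c ℤ.* eval (λ β → φ (α ⊕ β)) g
eval-term-* φ c α []            = sym (ℤ.*-zeroʳ c)
eval-term-* φ c α ((d , β) ∷ g) = trans
  (cong₂ ℤ._+_ (ℤ.*-assoc c d _) (eval-term-* φ c α g))
  (sym (ℤ.*-distribˡ-+ c _ _))

eval-* : (φ : Exponents n → ℤ) (f g : Poly n) →
         eval φ (f *ₚ g) ≡ eval (λ α → eval (λ β → φ (α ⊕ β)) g) f
eval-* φ []            g = refl
eval-* φ ((c , α) ∷ f) g = trans
  (eval-++ φ (List.map _ g) (f *ₚ g))
  (cong₂ ℤ._+_ (eval-term-* φ c α g) (eval-* φ f g))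

eval-constant : (φ : Exponents n → ℤ) (c : ℤ) → eval φ (constant c) ≡ c ℤ.* φ (replicate n 0)
eval-constant φ c = ℤ.+-identityʳ _

≈ₚ-by-eval : {f g : Poly n} → (∀ φ → eval φ f ≡ eval φ g) → f ≈ₚ g
≈ₚ-by-eval {f = f} {g} p = coeffwise λ γ → trans (coeff≡eval f γ) (trans (p (δ γ)) (sym (coeff≡eval g γ)))

eval-δ : {f g : Poly n} → f ≈ₚ g → ∀ γ → eval (δ γ) f ≡ eval (δ γ) g
eval-δ {f = f} {g} p γ = trans (sym (coeff≡eval f γ)) (trans (coeff-≡ p γ) (coeff≡eval g γ))

⊕-assoc : (α β γ : Exponents n) → (α ⊕ β) ⊕ γ ≡ α ⊕ (β ⊕ γ)
⊕-assoc = Vec.zipWith-assoc ℕ.+-assoc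

⊕-comm : (α β : Exponents n) → α ⊕ β ≡ β ⊕ α
⊕-comm = Vec.zipWith-comm ℕ.+-comm

⊕-identityˡ : (α : Exponents n) → replicate n 0 ⊕ α ≡ α
⊕-identityˡ = Vec.zipWith-identityˡ ℕ.+-identityˡ

-- A shifted δ is again a δ, or zero.
eval-shift : {f g : Poly n} → f ≈ₚ g → ∀ α γ →
             eval (λ β → δ γ (α ⊕ β)) f ≡ eval (λ β → δ γ (α ⊕ β)) g
eval-shift {n} {f} {g} p α γ with (α ⊕ zipWith _∸_ γ α) ≟ᴱ γ
... | yes eq = trans (eval-cong shift f) (trans (eval-δ p (zipWith _∸_ γ α)) (sym (eval-cong shift g)))
  where
  cancel : ∀ {m} (α β γ : Exponents m) → α ⊕ β ≡ γ → β ≡ zipWith _∸_ γ α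
  cancel []      []      []      _  = refl
  cancel (a ∷ α) (b ∷ β) (.(a ℕ.+ b) ∷ .(α ⊕ β)) refl =
    cong₂ _∷_ (sym (ℕ.m+n∸m≡n a b)) (cancel α β (α ⊕ β) refl)
  shift : ∀ β → δ γ (α ⊕ β) ≡ δ (zipWith _∸_ γ α) β
  shift β with (α ⊕ β) ≟ᴱ γ | β ≟ᴱ zipWith _∸_ γ α
  ... | yes _ | yes _ = refl
  ... | no _  | no _  = refl
  ... | yes q | no ¬q with () ← ¬q (cancel α β γ q)
  ... | no ¬q | yes q with () ← ¬q (trans (cong (α ⊕_) q) eq)
... | no ≢γ = trans (vanish f) (sym (vanish g))
  where
  restore : ∀ {m} (α β γ : Exponents m) → α ⊕ β ≡ γ → α ⊕ zipWith _∸_ γ α ≡ γ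
  restore []      []      []      _  = refl
  restore (a ∷ α) (b ∷ β) (.(a ℕ.+ b) ∷ .(α ⊕ β)) refl =
    cong₂ _∷_ (cong (a ℕ.+_) (ℕ.m+n∸m≡n a b)) (restore α β (α ⊕ β) refl)
  δ≡0 : ∀ β → δ γ (α ⊕ β) ≡ 0ℤ
  δ≡0 β with (α ⊕ β) ≟ᴱ γ
  ... | no _  = refl
  ... | yes q with () ← ≢γ (restore α β γ q)
  vanish : ∀ h → eval (λ β → δ γ (α ⊕ β)) h ≡ 0ℤ
  vanish h = trans (eval-cong δ≡0 h) (eval-zero h)

≈ₚ-refl : {f : Poly n} → f ≈ₚ f
≈ₚ-refl = coeffwise λ _ → refl

≈ₚ-sym : {f g : Poly n} → f ≈ₚ g → g ≈ₚ f
≈ₚ-sym p = coeffwise λ γ → sym (coeff-≡ p γ)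

≈ₚ-trans : {f g h : Poly n} → f ≈ₚ g → g ≈ₚ h → f ≈ₚ h
≈ₚ-trans p q = coeffwise λ γ → trans (coeff-≡ p γ) (coeff-≡ q γ)

+ₚ-cong : {f f′ g g′ : Poly n} → f ≈ₚ f′ → g ≈ₚ g′ → f +ₚ g ≈ₚ f′ +ₚ g′
+ₚ-cong {f = f} {f′} {g} {g′} p q = coeffwise λ γ → begin
  coeff (f +ₚ g) γ                       ≡⟨ coeff≡eval (f +ₚ g) γ ⟩
  eval (δ γ) (f +ₚ g)                    ≡⟨ eval-++ (δ γ) f g ⟩
  eval (δ γ) f ℤ.+ eval (δ γ) g          ≡⟨ cong₂ ℤ._+_ (eval-δ p γ) (eval-δ q γ) ⟩
  eval (δ γ) f′ ℤ.+ eval (δ γ) g′        ≡⟨ eval-++ (δ γ) f′ g′ ⟨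
  eval (δ γ) (f′ +ₚ g′)                  ≡⟨ coeff≡eval (f′ +ₚ g′) γ ⟨
  coeff (f′ +ₚ g′) γ                     ∎

-ₚ-cong : {f g : Poly n} → f ≈ₚ g → -ₚ f ≈ₚ -ₚ g
-ₚ-cong {f = f} {g} p = coeffwise λ γ → begin
  coeff (-ₚ f) γ        ≡⟨ coeff≡eval (-ₚ f) γ ⟩
  eval (δ γ) (-ₚ f)     ≡⟨ eval-neg (δ γ) f ⟩
  ℤ.- eval (δ γ) f      ≡⟨ cong ℤ.-_ (eval-δ p γ) ⟩
  ℤ.- eval (δ γ) g      ≡⟨ eval-neg (δ γ) g ⟨
  eval (δ γ) (-ₚ g)     ≡⟨ coeff≡eval (-ₚ g) γ ⟨
  coeff (-ₚ g) γ        ∎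

*ₚ-comm : (f g : Poly n) → f *ₚ g ≈ₚ g *ₚ f
*ₚ-comm f g = ≈ₚ-by-eval λ φ → begin
  eval φ (f *ₚ g)                              ≡⟨ eval-* φ f g ⟩
  eval (λ α → eval (λ β → φ (α ⊕ β)) g) f      ≡⟨ eval-swap (λ α β → φ (α ⊕ β)) f g ⟩
  eval (λ β → eval (λ α → φ (α ⊕ β)) f) g
    ≡⟨ eval-cong (λ β → eval-cong (λ α → cong φ (⊕-comm α β)) f) g ⟩
  eval (λ β → eval (λ α → φ (β ⊕ α)) f) g      ≡⟨ eval-* φ g f ⟨
  eval φ (g *ₚ f)                              ∎

*ₚ-congˡ : (h : Poly n) {f g : Poly n} → f ≈ₚ g → h *ₚ f ≈ₚ h *ₚ g
*ₚ-congˡ h {f} {g} p = coeffwise λ γ → begin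
  coeff (h *ₚ f) γ                             ≡⟨ coeff≡eval (h *ₚ f) γ ⟩
  eval (δ γ) (h *ₚ f)                          ≡⟨ eval-* (δ γ) h f ⟩
  eval (λ α → eval (λ β → δ γ (α ⊕ β)) f) h    ≡⟨ eval-cong (λ α → eval-shift p α γ) h ⟩
  eval (λ α → eval (λ β → δ γ (α ⊕ β)) g) h    ≡⟨ eval-* (δ γ) h g ⟨
  eval (δ γ) (h *ₚ g)                          ≡⟨ coeff≡eval (h *ₚ g) γ ⟨
  coeff (h *ₚ g) γ                             ∎

*ₚ-cong : {f f′ g g′ : Poly n} → f ≈ₚ f′ → g ≈ₚ g′ → f *ₚ g ≈ₚ f′ *ₚ g′
*ₚ-cong {f = f} {f′} {g} {g′} p q =
  ≈ₚ-trans (*ₚ-congˡ f q) (≈ₚ-trans (*ₚ-comm f g′) (≈ₚ-trans (*ₚ-congˡ g′ p) (*ₚ-comm g′ f′)))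

*ₚ-assoc : (f g h : Poly n) → (f *ₚ g) *ₚ h ≈ₚ f *ₚ (g *ₚ h)
*ₚ-assoc f g h = ≈ₚ-by-eval λ φ → begin
  eval φ ((f *ₚ g) *ₚ h)
    ≡⟨ eval-* φ (f *ₚ g) h ⟩
  eval (λ α → eval (λ γ → φ (α ⊕ γ)) h) (f *ₚ g)
    ≡⟨ eval-* _ f g ⟩
  eval (λ α → eval (λ β → eval (λ γ → φ ((α ⊕ β) ⊕ γ)) h) g) f
    ≡⟨ eval-cong (λ α → eval-cong (λ β → eval-cong (λ γ → cong φ (⊕-assoc α β γ)) h) g) f ⟩
  eval (λ α → eval (λ β → eval (λ γ → φ (α ⊕ (β ⊕ γ))) h) g) f
    ≡⟨ eval-cong (λ α → eval-* (λ β → φ (α ⊕ β)) g h) f ⟨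
  eval (λ α → eval (λ β → φ (α ⊕ β)) (g *ₚ h)) f
    ≡⟨ eval-* φ f (g *ₚ h) ⟨
  eval φ (f *ₚ (g *ₚ h)) ∎

*ₚ-identityˡ : (f : Poly n) → 1ₚ *ₚ f ≈ₚ f
*ₚ-identityˡ {n} f = ≈ₚ-by-eval λ φ → begin
  eval φ (1ₚ *ₚ f)                                        ≡⟨ eval-* φ 1ₚ f ⟩
  eval (λ α → eval (λ β → φ (α ⊕ β)) f) 1ₚ                ≡⟨ eval-constant (λ α → eval (λ β → φ (α ⊕ β)) f) 1ℤ ⟩
  1ℤ ℤ.* eval (λ β → φ (replicate n 0 ⊕ β)) f             ≡⟨ ℤ.*-identityˡ _ ⟩
  eval (λ β → φ (replicate n 0 ⊕ β)) f                    ≡⟨ eval-cong (λ β → cong φ (⊕-identityˡ β)) f ⟩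
  eval φ f                                                ∎

*ₚ-distribʳ : (h f g : Poly n) → (f +ₚ g) *ₚ h ≈ₚ f *ₚ h +ₚ g *ₚ h
*ₚ-distribʳ h f g = ≈ₚ-by-eval λ φ → begin
  eval φ ((f +ₚ g) *ₚ h)                    ≡⟨ eval-* φ (f +ₚ g) h ⟩
  eval _ (f +ₚ g)                           ≡⟨ eval-++ _ f g ⟩
  eval _ f ℤ.+ eval _ g                     ≡⟨ cong₂ ℤ._+_ (eval-* φ f h) (eval-* φ g h) ⟨
  eval φ (f *ₚ h) ℤ.+ eval φ (g *ₚ h)       ≡⟨ eval-++ φ (f *ₚ h) (g *ₚ h) ⟨
  eval φ (f *ₚ h +ₚ g *ₚ h)                 ∎

+ₚ-comm : (f g : Poly n) → f +ₚ g ≈ₚ g +ₚ f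
+ₚ-comm f g = ≈ₚ-by-eval λ φ →
  trans (eval-++ φ f g) (trans (ℤ.+-comm (eval φ f) (eval φ g)) (sym (eval-++ φ g f)))

+ₚ-assoc : (f g h : Poly n) → (f +ₚ g) +ₚ h ≈ₚ f +ₚ (g +ₚ h)
+ₚ-assoc f g h = ≈ₚ-by-eval λ φ → begin
  eval φ ((f +ₚ g) +ₚ h)                   ≡⟨ eval-++ φ (f +ₚ g) h ⟩
  eval φ (f +ₚ g) ℤ.+ eval φ h             ≡⟨ cong (ℤ._+ eval φ h) (eval-++ φ f g) ⟩
  eval φ f ℤ.+ eval φ g ℤ.+ eval φ h       ≡⟨ ℤ.+-assoc (eval φ f) (eval φ g) (eval φ h) ⟩
  eval φ f ℤ.+ (eval φ g ℤ.+ eval φ h)     ≡⟨ cong (ℤ._+_ (eval φ f)) (eval-++ φ g h) ⟨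
  eval φ f ℤ.+ eval φ (g +ₚ h)             ≡⟨ eval-++ φ f (g +ₚ h) ⟨
  eval φ (f +ₚ (g +ₚ h))                   ∎

+ₚ-inverseˡ : (f : Poly n) → -ₚ f +ₚ f ≈ₚ 0ₚ
+ₚ-inverseˡ f = ≈ₚ-by-eval λ φ → begin
  eval φ (-ₚ f +ₚ f)                ≡⟨ eval-++ φ (-ₚ f) f ⟩
  eval φ (-ₚ f) ℤ.+ eval φ f        ≡⟨ cong (ℤ._+ eval φ f) (eval-neg φ f) ⟩
  ℤ.- eval φ f ℤ.+ eval φ f         ≡⟨ ℤ.+-inverseˡ (eval φ f) ⟩
  0ℤ                                ∎

ℤ[x] : ℕ → CommutativeRing 0ℓ 0ℓ
ℤ[x] n = record
  { Carrier = Poly n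
  ; _≈_     = _≈ₚ_
  ; _+_     = _+ₚ_
  ; _*_     = _*ₚ_
  ; -_      = -ₚ_
  ; 0#      = 0ₚ
  ; 1#      = 1ₚ
  ; isCommutativeRing = record
    { isRing = record
      { +-isAbelianGroup = record
        { isGroup = record
          { isMonoid = record
            { isSemigroup = record
              { isMagma = record
                { isEquivalence = record { refl = ≈ₚ-refl ; sym = ≈ₚ-sym ; trans = ≈ₚ-trans }
                ; ∙-cong = +ₚ-cong
                }
              ; assoc = +ₚ-assoc
              }
            ; identity = (λ _ → ≈ₚ-refl) , (λ f → +ₚ-comm f 0ₚ)
            }
          ; inverse = +ₚ-inverseˡ , (λ f → ≈ₚ-trans (+ₚ-comm f (-ₚ f)) (+ₚ-inverseˡ f))
          ; ⁻¹-cong = -ₚ-cong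
          }
        ; comm = +ₚ-comm
        }
      ; *-cong     = *ₚ-cong
      ; *-assoc    = *ₚ-assoc
      ; *-identity = *ₚ-identityˡ , (λ f → ≈ₚ-trans (*ₚ-comm f 1ₚ) (*ₚ-identityˡ f))
      ; distrib    = (λ h f g → ≈ₚ-trans (*ₚ-comm h (f +ₚ g)) (≈ₚ-trans (*ₚ-distribʳ h f g)
                       (+ₚ-cong (*ₚ-comm f h) (*ₚ-comm g h))))
                   , *ₚ-distribʳ
      }
    ; *-comm = *ₚ-comm
    }
  }

constant-+ : (c d : ℤ) → constant {n} (c ℤ.+ d) ≈ₚ constant c +ₚ constant d
constant-+ {n} c d = ≈ₚ-by-eval λ φ → begin
  eval φ (constant (c ℤ.+ d))                                ≡⟨ eval-constant φ (c ℤ.+ d) ⟩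
  (c ℤ.+ d) ℤ.* φ (replicate n 0)                            ≡⟨ ℤ.*-distribʳ-+ _ c d ⟩
  c ℤ.* φ (replicate n 0) ℤ.+ d ℤ.* φ (replicate n 0)        ≡⟨ cong₂ ℤ._+_ (eval-constant φ c) (eval-constant φ d) ⟨
  eval φ (constant c) ℤ.+ eval φ (constant d)                ≡⟨ eval-++ φ (constant c) (constant d) ⟨
  eval φ (constant c +ₚ constant d)                          ∎

constant-* : (c d : ℤ) → constant {n} (c ℤ.* d) ≈ₚ constant c *ₚ constant d
constant-* {n} c d = ≈ₚ-by-eval λ φ →
  cong (λ α → c ℤ.* d ℤ.* φ α ℤ.+ 0ℤ) (sym (⊕-identityˡ (replicate n 0)))

constant-0 : constant {n} 0ℤ ≈ₚ 0ₚ
constant-0 = ≈ₚ-by-eval λ _ → refl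

module _ {k : ℕ} (g : Functional.Vector (Poly n) k) where

  open RingMorphisms ℤ.+-*-rawRing (CommutativeRing.rawRing (ℤ[x] n /⟨ g ⟩)) using (IsRingHomomorphism)

  private
    up : (f f′ : Poly n) → f ≈ₚ f′ → Congruent (ℤ[x] n) g f f′
    up f f′ = ≈⇒congruent (ℤ[x] n) g {f} {f′}

  constant-isRingHomomorphism : IsRingHomomorphism constant
  constant-isRingHomomorphism = record
    { isSemiringHomomorphism = record
      { isNearSemiringHomomorphism = record
        { +-isMonoidHomomorphism = record
          { isMagmaHomomorphism = record
            { isRelHomomorphism = record { cong = λ { {c} refl → up (constant c) (constant c) ≈ₚ-refl } }
            ; homo = λ c d → up (constant (c ℤ.+ d)) (constant c +ₚ constant d) (constant-+ c d)
            }
          ; ε-homo = up (constant 0ℤ) 0ₚ constant-0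
          }
        ; *-homo = λ c d → up (constant (c ℤ.* d)) (constant c *ₚ constant d) (constant-* c d)
        }
      ; 1#-homo = up 1ₚ 1ₚ ≈ₚ-refl
      }
    ; -‿homo = λ c → up (constant (ℤ.- c)) (-ₚ constant c) ≈ₚ-refl
    }

  quotientModule : Module ℤ.+-*-commutativeRing 0ℓ 0ℓ
  quotientModule =
    algebraModule ℤ.+-*-commutativeRing (ℤ[x] n /⟨ g ⟩) constant constant-isRingHomomorphism

-- The exponents of the monomials of degree r in the variables in S, each once.
exponentsOfDegree : Subset n → ℕ → List (Exponents n)
exponentsOfDegree []            zero    = [] ∷ []
exponentsOfDegree []            (suc r) = []
exponentsOfDegree (outside ∷ S) r       = List.map (0 ∷_) (exponentsOfDegree S r)
exponentsOfDegree (inside  ∷ S) r       =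
  concatMap (λ a → List.map (a ∷_) (exponentsOfDegree S (r ∸ a))) (upTo (suc r))

-- The complete homogeneous symmetric polynomial (written ẽ, although it is
-- not the elementary one).
ẽ : ℕ → Subset n → Poly n
ẽ r S = List.map (1ℤ ,_) (exponentsOfDegree S r)

-- {1,…,n} is represented by Fin n, so i : Fin n stands for suc (toℕ i).

record IsHessenberg (h : Fin n → Fin n) : Set where
  field
    extensive : ∀ i → i Fin.≤ h i
    monotone  : ∀ i j → toℕ j ≡ suc (toℕ i) → h i Fin.≤ h j

-- At most toℕ i many k satisfy h k < i when h is Hessenberg, so the
-- subtraction does not truncate.
degree : (Fin n → Fin n) → Fin n → ℕ
degree {n} h i = suc (toℕ i) ∸ count (λ k → h k Fin.<? i) (allFin n)

-- {xᵢ,…,xₙ}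
variablesFrom : Fin n → Subset n
variablesFrom i = tabulate (λ j → does (i Fin.≤? j))

generators : (Fin n → Fin n) → Functional.Vector (Poly n) n
generators h i = ẽ (degree h i) (variablesFrom i)

-- The bound is irrelevant, so that two elements with the same exponents are equal.
record BoundedExponents (b : Fin n → ℕ) : Set where
  constructor bounded
  field
    exponents : Exponents n
    .bound    : ∀ i → lookup exponents i ℕ.< b i
open BoundedExponents public using (exponents)

-- The family of monomials x^α with αᵢ ≤ βᵢ − 1, indexed by α.
𝓑 : (h : Fin n → Fin n) → BoundedExponents (degree h) → Poly n
𝓑 h α = monomial (exponents α)

{-# OPTIONS --safe #-}

-- The i-th generator ẽ_{βᵢ}(xᵢ,…,xₙ) is monic of degree βᵢ in xᵢ with
-- coefficients in ℤ[xᵢ₊₁,…,xₙ], so R / J_h is a tower of quotients by monic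
-- polynomials.  Argue by induction on n, adjoining x₁ and a monic polynomial
-- p = x₁^d + ∑_{j<d} cⱼ x₁^j.  Division by p gives spanning.  For independence,
-- each functional on ℤ[x₂,…,xₙ] that kills the smaller ideal extends to R by
-- prescribing it on the slices x₁^a with a < d and continuing by the linear
-- recurrence that p imposes; these extensions kill the larger ideal and separate
-- the monomials in 𝓑.

module Submission where

open import Defs
open import Data.Nat.Base using (ℕ)
open import Data.Fin.Base using (Fin)
open import Algebra.Bundles using (CommutativeRing)
open import Algebra.Module.Bundles using (Module)
import Algebra.Properties.Ring as RingProperties
import Algebra.Properties.Semiring.Sum as SemiringSum
open import Data.Bool.Base using (true; false; if_then_else_; _∧_)
open import Data.Fin.Base as Fin using (zero; suc; toℕ)
import Data.Fin.Properties as Fin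
open import Data.Fin.Subset using (Subset; inside; outside)
open import Data.Integer.Base as ℤ using (ℤ; 0ℤ; 1ℤ; -1ℤ)
import Data.Integer.Properties as ℤ
open import Data.List.Base as List using (List; []; _∷_; _++_; concatMap; applyUpTo)
import Data.List.Properties as List
open import Data.List.Relation.Unary.All as All using (All; []; _∷_)
import Data.List.Relation.Unary.All.Properties as All
open import Data.List.Relation.Unary.AllPairs using ([]; _∷_)
open import Data.List.Relation.Unary.Unique.Propositional using (Unique)
open import Data.Nat.Base as ℕ using (zero; suc; _∸_; _<_)
import Data.Nat.Properties as ℕ
open import Data.Nat.Induction using (<-wellFounded)
open import Data.Product.Base using (_×_; _,_; proj₂; ∃-syntax)
open import Data.Vec.Base as Vec using ([]; _∷_; lookup; replicate)
import Data.Vec.Functional as Functional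
import Data.Vec.Properties as Vec
open import Function.Base using (_∘_; _on_)
open import Induction.WellFounded as WF using (WellFounded; WfRec)
open import Level using (0ℓ)
import Relation.Binary.Construct.On as On
open import Relation.Binary.PropositionalEquality
  using (_≡_; refl; sym; trans; cong; cong₂; subst; module ≡-Reasoning)
open import Relation.Nullary using (¬_; Dec; yes; no; does; contradiction)
open import Relation.Nullary.Decidable using (recompute; dec-true; dec-false)

private
  variable
    n k : ℕ

  module Sumℤ = SemiringSum ℤ.+-*-semiring
  module Sumₚ (n : ℕ) = SemiringSum (CommutativeRing.semiring (ℤ[x] n))

-- Functionals on polynomials and finite sums

∑ : (Fin k → ℤ) → ℤ
∑ = Sumℤ.sum

∑ₚ : (Fin k → Poly n) → Poly n
∑ₚ {n = n} = Sumₚ.sum n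

open ≡-Reasoning

eval-∑ₚ : (φ : Exponents n → ℤ) (v : Fin k → Poly n) → eval φ (∑ₚ v) ≡ ∑ (λ i → eval φ (v i))
eval-∑ₚ {k = zero}  φ v = refl
eval-∑ₚ {k = suc k} φ v =
  trans (eval-++ φ (v zero) (∑ₚ (v ∘ suc))) (cong (ℤ._+_ (eval φ (v zero))) (eval-∑ₚ φ (v ∘ suc)))

eval-∑ : (φ : Fin k → Exponents n → ℤ) (f : Poly n) →
         eval (λ α → ∑ (λ i → φ i α)) f ≡ ∑ (λ i → eval (φ i) f)
eval-∑ {k = zero}  φ f = eval-zero f
eval-∑ {k = suc k} φ f =
  trans (eval-add (φ zero) _ f) (cong (ℤ._+_ (eval (φ zero) f)) (eval-∑ (φ ∘ suc) f))

∑-zero : {v : Fin k → ℤ} → (∀ i → v i ≡ 0ℤ) → ∑ v ≡ 0ℤ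
∑-zero {k} v≡0 = trans (Sumℤ.sum-cong-≗ v≡0) (Sumℤ.sum-replicate-zero k)

δ-refl : (α : Exponents n) → δ α α ≡ 1ℤ
δ-refl α = cong (if_then 1ℤ else 0ℤ) (dec-true (α ≟ᴱ α) refl)

δ-≢ : {α γ : Exponents n} → ¬ α ≡ γ → δ γ α ≡ 0ℤ
δ-≢ {α = α} {γ} α≢γ = cong (if_then 1ℤ else 0ℤ) (dec-false (α ≟ᴱ γ) α≢γ)

-- The formal sum `p` is read as a list of weights on the functionals `δ γ`. Going through `f`, a
-- multiple of `δ α` is added that corrects the value at `α`; it vanishes at every other exponent,
-- so the values already matched there survive.
interpolate : (φ : Exponents n → ℤ) (f : Poly n) →
              ∃[ p ] All (λ (_ , α) → φ α ≡ eval (λ γ → δ γ α) p) f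
interpolate φ []            = [] , []
interpolate {n} φ ((c , α) ∷ f) =
  let p , φ≡p = interpolate φ f
  in ((φ α ℤ.- eval (λ γ → δ γ α) p , α) ∷ p) , hit p ∷ All.map (λ {t} → extend p {t}) φ≡p
  where
  hit : ∀ p → φ α ≡ (φ α ℤ.- eval (λ γ → δ γ α) p) ℤ.* δ α α ℤ.+ eval (λ γ → δ γ α) p
  hit p = sym (begin
    (φ α ℤ.- e) ℤ.* δ α α ℤ.+ e   ≡⟨ cong (λ d → (φ α ℤ.- e) ℤ.* d ℤ.+ e) (δ-refl α) ⟩
    (φ α ℤ.- e) ℤ.* 1ℤ ℤ.+ e      ≡⟨ cong (ℤ._+ e) (ℤ.*-identityʳ (φ α ℤ.- e)) ⟩
    (φ α ℤ.- e) ℤ.+ e             ≡⟨ ℤ.+-assoc (φ α) (ℤ.- e) e ⟩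
    φ α ℤ.+ (ℤ.- e ℤ.+ e)         ≡⟨ cong (ℤ._+_ (φ α)) (ℤ.+-inverseˡ e) ⟩
    φ α ℤ.+ 0ℤ                    ≡⟨ ℤ.+-identityʳ (φ α) ⟩
    φ α                           ∎)
    where e = eval (λ γ → δ γ α) p
  extend : ∀ p {t : ℤ × Exponents n} → φ (proj₂ t) ≡ eval (λ γ → δ γ (proj₂ t)) p →
           φ (proj₂ t) ≡ (φ α ℤ.- eval (λ γ → δ γ α) p) ℤ.* δ α (proj₂ t)
                         ℤ.+ eval (λ γ → δ γ (proj₂ t)) p
  extend p {_ , β} eq with β ≟ᴱ α
  -- The exponent `α` occurs again in the tail: the correction is then computed as at the head.
  ... | yes refl = subst (λ d → φ α ≡ (φ α ℤ.- eval (λ γ → δ γ α) p) ℤ.* d ℤ.+ eval (λ γ → δ γ α) p)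
                         (δ-refl α) (hit p)
  ... | no  _    = trans eq (sym (trans
    (cong (ℤ._+ eval (λ γ → δ γ β) p) (ℤ.*-zeroʳ (φ α ℤ.- eval (λ γ → δ γ α) p)))
    (ℤ.+-identityˡ _)))

eval-cong-All : {φ ψ : Exponents n → ℤ} {f : Poly n} →
                All (λ (_ , α) → φ α ≡ ψ α) f → eval φ f ≡ eval ψ f
eval-cong-All []       = refl
eval-cong-All (_∷_ {x = c , _} p ps) = cong₂ ℤ._+_ (cong (c ℤ.*_) p) (eval-cong-All ps)

-- ≈ₚ only controls the functionals δ γ; on the exponents of f and g, φ is a combination of these.
eval-resp-≈ₚ : (φ : Exponents n → ℤ) {f g : Poly n} → f ≈ₚ g → eval φ f ≡ eval φ g
eval-resp-≈ₚ φ {f} {g} f≈g with p , φ≡p ← interpolate φ (f ++ g) = begin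
  eval φ f                               ≡⟨ eval-cong-All (All.++⁻ˡ f φ≡p) ⟩
  eval (λ α → eval (λ γ → δ γ α) p) f    ≡⟨ eval-swap (λ α γ → δ γ α) f p ⟩
  eval (λ γ → eval (δ γ) f) p            ≡⟨ eval-cong (eval-δ f≈g) p ⟩
  eval (λ γ → eval (δ γ) g) p            ≡⟨ eval-swap (λ α γ → δ γ α) g p ⟨
  eval (λ α → eval (λ γ → δ γ α) p) g    ≡⟨ eval-cong-All (All.++⁻ʳ f φ≡p) ⟨
  eval φ g                               ∎

-- Functionals vanishing on an ideal

-- Letting `α` range over all monomials makes `ψ` kill the whole ideal by additivity, and not merely
-- the generators.
Annihilates : (Exponents n → ℤ) → Functional.Vector (Poly n) k → Set
Annihilates ψ g = ∀ i α → eval (λ β → ψ (α ⊕ β)) (g i) ≡ 0ℤ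

Annihilates⇒eval≡0 : {ψ : Exponents n → ℤ} {g : Functional.Vector (Poly n) k} {f : Poly n} →
                     Annihilates ψ g → _∈⟨_⟩ (ℤ[x] n) f g → eval ψ f ≡ 0ℤ
Annihilates⇒eval≡0 {ψ = ψ} {g} {f} ann (a , f≈) = begin
  eval ψ f                             ≡⟨ eval-resp-≈ₚ ψ f≈ ⟩
  eval ψ (∑ₚ (λ i → a i *ₚ g i))       ≡⟨ eval-∑ₚ ψ (λ i → a i *ₚ g i) ⟩
  ∑ (λ i → eval ψ (a i *ₚ g i))        ≡⟨ ∑-zero (λ i → begin
    eval ψ (a i *ₚ g i)                           ≡⟨ eval-* ψ (a i) (g i) ⟩
    eval (λ α → eval (λ β → ψ (α ⊕ β)) (g i)) (a i)  ≡⟨ eval-cong (ann i) (a i) ⟩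
    eval (λ _ → 0ℤ) (a i)                         ≡⟨ eval-zero (a i) ⟩
    0ℤ                                            ∎) ⟩
  0ℤ                                   ∎

-- Normal forms

toPoly : {b : Fin n → ℕ} → List (ℤ × BoundedExponents b) → Poly n
toPoly = List.map (λ (c , α) → c , exponents α)

Spanned : Functional.Vector (Poly n) k → (Fin n → ℕ) → Poly n → Set
Spanned {n} g b f = ∃[ t ] Congruent (ℤ[x] n) g f (toPoly {b = b} t)

-- The invariant of the induction. Independence is carried as functionals on all of the polynomial
-- ring, because these extend along a monic polynomial by a recurrence.
record NormalForms (g : Functional.Vector (Poly n) k) (b : Fin n → ℕ) : Set where
  field
    spanned          : ∀ f → Spanned g b f
    -- For γ bounded by b, eval (dual γ) f is the coefficient of x^γ in the normal form of f.
    dual             : Exponents n → Exponents n → ℤ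
    dual-annihilates : ∀ γ → Annihilates (dual γ) g
    dual≡δ           : ∀ γ α → (∀ i → lookup α i < b i) → dual γ α ≡ δ γ α

-- From normal forms to a basis

module _ {r ℓr m ℓm} {S : CommutativeRing r ℓr} (M : Module S m ℓm) {i} {I : Set i} where

  open Module M

  linearCombination-∷ : ∀ (v : I → Carrierᴹ) c i t →
    linearCombination M v ((c , i) ∷ t) ≡ (c *ₗ v i) +ᴹ linearCombination M v t
  linearCombination-∷ v c i t = refl

module _ {g : Functional.Vector (Poly n) k} {b : Fin n → ℕ} (N : NormalForms g b) where

  open NormalForms N

  monomials : BoundedExponents b → Poly n
  monomials α = monomial (exponents α)

  private
    combination : List (ℤ × BoundedExponents b) → Poly n
    combination = linearCombination (quotientModule g) monomials

  combination-∷ : ∀ c α t → combination ((c , α) ∷ t) ≡ constant c *ₚ monomials α +ₚ combination t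
  -- In two steps, because refl alone sends the conversion checker through the whole module structure.
  combination-∷ c α t = trans (linearCombination-∷ (quotientModule g) monomials c α t) refl

  eval-combination : ∀ φ (t : List (ℤ × BoundedExponents b)) → eval φ (combination t) ≡ eval φ (toPoly t)
  eval-combination φ []            = refl
  eval-combination φ ((c , α) ∷ t) = begin
    eval φ (combination ((c , α) ∷ t))
      ≡⟨ cong (eval φ) (combination-∷ c α t) ⟩
    eval φ (constant c *ₚ monomials α +ₚ combination t)
      ≡⟨ cong₂ ℤ._+_ (cong₂ (λ d γ → d ℤ.* φ γ) (ℤ.*-identityʳ c) (⊕-identityˡ (exponents α)))
                     (eval-combination φ t) ⟩
    eval φ (toPoly ((c , α) ∷ t)) ∎

  -- The bound is stored irrelevantly; decidability of `<` recovers a usable proof.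
  bounds : (α : BoundedExponents b) → ∀ i → lookup (exponents α) i < b i
  bounds (bounded α α<b) i = recompute (lookup α i ℕ.<? b i) (α<b i)

  -- Pairing with the functional dual to the head exponent isolates the head coefficient, since by
  -- uniqueness that exponent is absent from the tail. Once the coefficient is zero, the hypothesis
  -- passes to the tail.
  coefficients-zero : (t : List (ℤ × BoundedExponents b)) → Unique (List.map proj₂ t) →
                      (∀ (γ : BoundedExponents b) → eval (dual (exponents γ)) (toPoly t) ≡ 0ℤ) →
                      All (λ (c , _) → c ≡ 0ℤ) t
  coefficients-zero []            _         _    = []
  coefficients-zero ((c , α) ∷ t) (α∉ ∷ !t) dual≡0 =
    c≡0 ∷ coefficients-zero t !t λ γ → begin
      eval (dual (exponents γ)) (toPoly t)
        ≡⟨ ℤ.+-identityˡ _ ⟨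
      0ℤ ℤ.+ eval (dual (exponents γ)) (toPoly t)
        ≡⟨ cong (λ d → d ℤ.* dual (exponents γ) (exponents α) ℤ.+ eval (dual (exponents γ)) (toPoly t)) c≡0 ⟨
      eval (dual (exponents γ)) (toPoly ((c , α) ∷ t))
        ≡⟨ dual≡0 γ ⟩
      0ℤ ∎
    where
    tail≡0 : ∀ s → All (λ γ → ¬ α ≡ γ) (List.map proj₂ s) → eval (dual (exponents α)) (toPoly s) ≡ 0ℤ
    tail≡0 []            []         = refl
    tail≡0 ((d , γ) ∷ s) (α≢γ ∷ α∉s) = cong₂ ℤ._+_
      (trans (cong (d ℤ.*_) (trans (dual≡δ (exponents α) (exponents γ) (bounds γ))
                                   -- Equal exponents give equal bounded exponents, by irrelevance
                                   -- of the bound.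
                                   (δ-≢ {α = exponents γ} {exponents α} λ { refl → α≢γ refl })))
             (ℤ.*-zeroʳ d))
      (tail≡0 s α∉s)
    c≡0 : c ≡ 0ℤ
    c≡0 = begin
      c
        ≡⟨ ℤ.*-identityʳ c ⟨
      c ℤ.* 1ℤ
        ≡⟨ cong (c ℤ.*_) (trans (dual≡δ (exponents α) (exponents α) (bounds α)) (δ-refl (exponents α))) ⟨
      c ℤ.* dual (exponents α) (exponents α)
        ≡⟨ ℤ.+-identityʳ _ ⟨
      c ℤ.* dual (exponents α) (exponents α) ℤ.+ 0ℤ
        ≡⟨ cong (ℤ._+_ (c ℤ.* dual (exponents α) (exponents α))) (tail≡0 t α∉) ⟨
      eval (dual (exponents α)) (toPoly ((c , α) ∷ t))
        ≡⟨ dual≡0 α ⟩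
      0ℤ ∎

  NormalForms⇒IsBasis : IsBasis (quotientModule g) monomials
  NormalForms⇒IsBasis = record
    { spanning    = λ f → let t , f≡t = spanned f in
        t , congruent-trans (ℤ[x] n) g f≡t
              (≈⇒congruent (ℤ[x] n) g (≈ₚ-by-eval λ φ → sym (eval-combination φ t)))
    ; independent = λ t !t (congruent lc∈) → coefficients-zero t !t λ γ → begin
        eval (dual (exponents γ)) (toPoly t)
          ≡⟨ eval-combination (dual (exponents γ)) t ⟨
        eval (dual (exponents γ)) (combination t)
          -- Congruence to zero speaks of the difference with `0ₚ`, which is the sum with an empty
          -- list.
          ≡⟨ cong (eval (dual (exponents γ))) (List.++-identityʳ (combination t)) ⟨
        eval (dual (exponents γ)) (combination t +ₚ -ₚ 0ₚ)
          ≡⟨ Annihilates⇒eval≡0 (dual-annihilates (exponents γ)) lc∈ ⟩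
        0ℤ ∎
    }

-- Adjoining a variable

-- x₁^a · f, the variables of f being renamed to x₂, …, xₙ₊₁.
prepend : ℕ → Poly n → Poly (suc n)
prepend a = List.map (λ (c , α) → c , a ∷ α)

eval-map : ∀ {m} (e : Exponents m → Exponents n) (φ : Exponents n → ℤ) (f : Poly m) →
           eval φ (List.map (λ (c , α) → c , e α) f) ≡ eval (φ ∘ e) f
eval-map e φ []            = refl
eval-map e φ ((c , α) ∷ f) = cong (ℤ._+_ (c ℤ.* φ (e α))) (eval-map e φ f)

eval-prepend : (φ : Exponents (suc n) → ℤ) (a : ℕ) (f : Poly n) →
               eval φ (prepend a f) ≡ eval (λ α → φ (a ∷ α)) f
eval-prepend φ a = eval-map (a ∷_) φ

prepend-cong : (a : ℕ) {f g : Poly n} → f ≈ₚ g → prepend a f ≈ₚ prepend a g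
prepend-cong a {f} {g} f≈g = ≈ₚ-by-eval λ φ → begin
  eval φ (prepend a f)          ≡⟨ eval-prepend φ a f ⟩
  eval (λ α → φ (a ∷ α)) f      ≡⟨ eval-resp-≈ₚ (λ α → φ (a ∷ α)) f≈g ⟩
  eval (λ α → φ (a ∷ α)) g      ≡⟨ eval-prepend φ a g ⟨
  eval φ (prepend a g)          ∎

prepend-* : (a b : ℕ) (f g : Poly n) → prepend a f *ₚ prepend b g ≈ₚ prepend (a ℕ.+ b) (f *ₚ g)
prepend-* a b f g = ≈ₚ-by-eval λ φ → begin
  eval φ (prepend a f *ₚ prepend b g)
    ≡⟨ eval-* φ (prepend a f) (prepend b g) ⟩
  eval (λ α → eval (λ β → φ (α ⊕ β)) (prepend b g)) (prepend a f)
    ≡⟨ eval-prepend _ a f ⟩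
  eval (λ α → eval (λ β → φ ((a ∷ α) ⊕ β)) (prepend b g)) f
    ≡⟨ eval-cong (λ α → eval-prepend (λ β → φ ((a ∷ α) ⊕ β)) b g) f ⟩
  eval (λ α → eval (λ β → φ (a ℕ.+ b ∷ α ⊕ β)) g) f
    ≡⟨ eval-* (λ γ → φ (a ℕ.+ b ∷ γ)) f g ⟨
  eval (λ γ → φ (a ℕ.+ b ∷ γ)) (f *ₚ g)
    ≡⟨ eval-prepend φ (a ℕ.+ b) (f *ₚ g) ⟨
  eval φ (prepend (a ℕ.+ b) (f *ₚ g)) ∎

prepend-∑ₚ : (a : ℕ) (v : Fin k → Poly n) → prepend a (∑ₚ v) ≡ ∑ₚ (λ i → prepend a (v i))
prepend-∑ₚ {k = zero}  a v = refl
prepend-∑ₚ {k = suc k} a v =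
  trans (List.map-++ _ (v zero) (∑ₚ (v ∘ suc))) (cong (prepend a (v zero) ++_) (prepend-∑ₚ a (v ∘ suc)))

prepend-neg : (a : ℕ) (f : Poly n) → prepend a (-ₚ f) ≡ -ₚ prepend a f
prepend-neg a f = trans (sym (List.map-∘ f)) (List.map-∘ f)

monic : {d : ℕ} → (Fin d → Poly n) → Poly (suc n)
monic {d = d} c = ∑ₚ (λ j → prepend (toℕ j) (c j)) +ₚ prepend d 1ₚ

eval-monic : ∀ {d} (c : Fin d → Poly n) (φ : Exponents (suc n) → ℤ) →
             eval φ (monic c) ≡ ∑ (λ j → eval (λ β → φ (toℕ j ∷ β)) (c j)) ℤ.+ φ (d ∷ replicate n 0)
eval-monic {n} {d} c φ = begin
  eval φ (monic c)
    ≡⟨ eval-++ φ (∑ₚ (λ j → prepend (toℕ j) (c j))) (prepend d 1ₚ) ⟩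
  eval φ (∑ₚ (λ j → prepend (toℕ j) (c j))) ℤ.+ eval φ (prepend d 1ₚ)
    ≡⟨ cong₂ ℤ._+_
         (trans (eval-∑ₚ φ (λ j → prepend (toℕ j) (c j))) (Sumℤ.sum-cong-≗ (λ j → eval-prepend φ (toℕ j) (c j))))
         (trans (ℤ.+-identityʳ _) (ℤ.*-identityˡ (φ (d ∷ replicate n 0)))) ⟩
  ∑ (λ j → eval (λ β → φ (toℕ j ∷ β)) (c j)) ℤ.+ φ (d ∷ replicate n 0) ∎

module Extension
  {g : Functional.Vector (Poly n) k} {b : Fin n → ℕ} (N : NormalForms g b)
  {g⁺ : Functional.Vector (Poly (suc n)) (suc k)} {b⁺ : Fin (suc n) → ℕ}
  (b-tail : ∀ i → b⁺ (suc i) ≡ b i)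
  (c : Fin (b⁺ zero) → Poly n)
  (g-head : g⁺ zero ≈ₚ monic c)
  (g-tail : ∀ i → g⁺ (suc i) ≡ prepend 0 (g i))
  where

  open NormalForms N

  private
    d = b⁺ zero

    restore : ∀ {a} → ¬ a < d → a ∸ d ℕ.+ d ≡ a
    restore a≮d = ℕ.m∸n+n≡m (ℕ.≮⇒≥ a≮d)

    -- The termination measure for spanning and for the dual functionals alike: one use of the monic
    -- relation replaces x₁^a by the powers x₁^(a-d+j) with j < d.
    descends : ∀ {a} → ¬ a < d → (j : Fin d) → a ∸ d ℕ.+ toℕ j < a
    descends {a} a≮d j = subst (a ∸ d ℕ.+ toℕ j <_) (restore a≮d) (ℕ.+-monoʳ-< (a ∸ d) (Fin.toℕ<n j))

    module P⁺ where
      open CommutativeRing (ℤ[x] (suc n)) public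
      open RingProperties ring public using (-‿involutive)

  -- Congruence modulo the larger ideal

  infix 4 _∼_

  _∼_ : Poly (suc n) → Poly (suc n) → Set
  _∼_ = Congruent (ℤ[x] (suc n)) g⁺

  ∼-trans : ∀ {f h e} → f ∼ h → h ∼ e → f ∼ e
  ∼-trans = congruent-trans (ℤ[x] (suc n)) g⁺

  ≈⇒∼ : ∀ {f h} → f ≈ₚ h → f ∼ h
  ≈⇒∼ = ≈⇒congruent (ℤ[x] (suc n)) g⁺

  -- The new generator gets coefficient 0; the others, being the old ones with variables renamed,
  -- get the old coefficients times x₁^a.
  prepend-∈ : ∀ a {f} → _∈⟨_⟩ (ℤ[x] n) f g → _∈⟨_⟩ (ℤ[x] (suc n)) (prepend a f) g⁺
  prepend-∈ a {f} (q , f≈) = Functional._∷_ 0ₚ (λ i → prepend a (q i)) ,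
    P⁺.trans (prepend-cong a f≈) (P⁺.trans (P⁺.reflexive (prepend-∑ₚ a (λ i → q i *ₚ g i)))
      (Sumₚ.sum-cong-≋ (suc n) λ i → P⁺.sym (P⁺.trans
        (P⁺.*-congˡ {prepend a (q i)} (P⁺.reflexive (g-tail i)))
        (P⁺.trans (prepend-* a 0 (q i) (g i))
                  (P⁺.reflexive (cong (λ e → prepend e (q i *ₚ g i)) (ℕ.+-identityʳ a)))))))

  prepend-congruent : ∀ a {f h} → Congruent (ℤ[x] n) g f h → prepend a f ∼ prepend a h
  prepend-congruent a {f} {h} (congruent f-h∈) = congruent
    (∈-resp-≈ (ℤ[x] (suc n)) g⁺
      (P⁺.reflexive (trans (List.map-++ _ f (-ₚ h)) (cong (prepend a f ++_) (prepend-neg a h))))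
      (prepend-∈ a f-h∈))

  head-multiple : ∀ q → _∈⟨_⟩ (ℤ[x] (suc n)) (q *ₚ g⁺ zero) g⁺
  head-multiple q = Functional._∷_ q (λ _ → 0ₚ) , P⁺.sym (P⁺.trans
    (P⁺.+-congˡ {q *ₚ g⁺ zero} (Sumₚ.sum-replicate-zero (suc n) k)) (P⁺.+-identityʳ (q *ₚ g⁺ zero)))

  prepend-*-monic : ∀ a f → prepend a f *ₚ monic c ≈ₚ
                    prepend (a ℕ.+ d) f +ₚ ∑ₚ (λ j → prepend (a ℕ.+ toℕ j) (f *ₚ c j))
  prepend-*-monic a f = ≈ₚ-by-eval λ φ → begin
    eval φ (prepend a f *ₚ monic c)
      ≡⟨ eval-* φ (prepend a f) (monic c) ⟩
    eval (λ α → eval (λ β → φ (α ⊕ β)) (monic c)) (prepend a f)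
      ≡⟨ eval-prepend _ a f ⟩
    eval (λ α → eval (λ β → φ ((a ∷ α) ⊕ β)) (monic c)) f
      ≡⟨ eval-cong (λ α → eval-monic c (λ β → φ ((a ∷ α) ⊕ β))) f ⟩
    eval (λ α → ∑ (λ j → eval (λ β → φ (a ℕ.+ toℕ j ∷ α ⊕ β)) (c j)) ℤ.+ φ (a ℕ.+ d ∷ α ⊕ replicate n 0)) f
      ≡⟨ eval-add _ _ f ⟩
    eval (λ α → ∑ (λ j → eval (λ β → φ (a ℕ.+ toℕ j ∷ α ⊕ β)) (c j))) f ℤ.+ eval (λ α → φ (a ℕ.+ d ∷ α ⊕ replicate n 0)) f
      ≡⟨ cong₂ ℤ._+_
           (trans (eval-∑ (λ j α → eval (λ β → φ (a ℕ.+ toℕ j ∷ α ⊕ β)) (c j)) f) (Sumℤ.sum-cong-≗ λ j → trans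
             (sym (eval-* (λ γ → φ (a ℕ.+ toℕ j ∷ γ)) f (c j)))
             (sym (eval-prepend φ (a ℕ.+ toℕ j) (f *ₚ c j)))))
           (trans (eval-cong (λ α → cong (λ γ → φ (a ℕ.+ d ∷ γ)) (Vec.zipWith-identityʳ ℕ.+-identityʳ α)) f)
             (sym (eval-prepend φ (a ℕ.+ d) f))) ⟩
    ∑ (λ j → eval φ (prepend (a ℕ.+ toℕ j) (f *ₚ c j))) ℤ.+ eval φ (prepend (a ℕ.+ d) f)
      ≡⟨ ℤ.+-comm _ (eval φ (prepend (a ℕ.+ d) f)) ⟩
    eval φ (prepend (a ℕ.+ d) f) ℤ.+ ∑ (λ j → eval φ (prepend (a ℕ.+ toℕ j) (f *ₚ c j)))
      ≡⟨ cong (ℤ._+_ (eval φ (prepend (a ℕ.+ d) f))) (eval-∑ₚ φ (λ j → prepend (a ℕ.+ toℕ j) (f *ₚ c j))) ⟨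
    eval φ (prepend (a ℕ.+ d) f) ℤ.+ eval φ (∑ₚ (λ j → prepend (a ℕ.+ toℕ j) (f *ₚ c j)))
      ≡⟨ eval-++ φ (prepend (a ℕ.+ d) f) _ ⟨
    eval φ (prepend (a ℕ.+ d) f +ₚ ∑ₚ (λ j → prepend (a ℕ.+ toℕ j) (f *ₚ c j))) ∎

  -- One step of polynomial division: the difference of the two sides is `prepend a f` times the
  -- monic polynomial.
  reduce : ∀ a f → prepend (a ℕ.+ d) f ∼ -ₚ ∑ₚ (λ j → prepend (a ℕ.+ toℕ j) (f *ₚ c j))
  reduce a f = congruent (∈-resp-≈ (ℤ[x] (suc n)) g⁺
    (P⁺.trans (P⁺.*-congˡ {prepend a f} g-head) (P⁺.trans (prepend-*-monic a f)
      (P⁺.+-congˡ {prepend (a ℕ.+ d) f} (P⁺.sym (P⁺.-‿involutive (∑ₚ (λ j → prepend (a ℕ.+ toℕ j) (f *ₚ c j))))))))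
    (head-multiple (prepend a f)))

  -- Spanning: division by the monic polynomial

  Spanned⁺ : Poly (suc n) → Set
  Spanned⁺ = Spanned g⁺ b⁺

  spanned-resp : ∀ {f h} → f ∼ h → Spanned⁺ h → Spanned⁺ f
  spanned-resp f∼h (t , h∼t) = t , ∼-trans f∼h h∼t

  spanned-+ : ∀ {f h} → Spanned⁺ f → Spanned⁺ h → Spanned⁺ (f +ₚ h)
  spanned-+ (s , f∼s) (t , h∼t) = s ++ t , ∼-trans
    (+-congruent (ℤ[x] (suc n)) g⁺ f∼s h∼t) (≈⇒∼ (P⁺.reflexive (sym (List.map-++ _ s t))))

  spanned-neg : ∀ {f} → Spanned⁺ f → Spanned⁺ (-ₚ f)
  spanned-neg (t , f∼t) = List.map (λ (e , α) → ℤ.- e , α) t , ∼-trans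
    (-‿congruent (ℤ[x] (suc n)) g⁺ f∼t)
    (≈⇒∼ (P⁺.reflexive (trans (sym (List.map-∘ t)) (List.map-∘ t))))

  spanned-0 : Spanned⁺ 0ₚ
  spanned-0 = [] , ≈⇒∼ ≈ₚ-refl

  spanned-∑ₚ : ∀ {m} (v : Fin m → Poly (suc n)) → (∀ i → Spanned⁺ (v i)) → Spanned⁺ (∑ₚ v)
  spanned-∑ₚ {zero}  v s = spanned-0
  spanned-∑ₚ {suc m} v s = spanned-+ (s zero) (spanned-∑ₚ (v ∘ suc) (s ∘ suc))

  _∷ᵇ_ : ∀ {a} → a < d → BoundedExponents b → BoundedExponents b⁺
  _∷ᵇ_ {a} a<d (bounded α α<b) = bounded (a ∷ α) λ
    { zero → a<d ; (suc i) → subst (lookup α i <_) (sym (b-tail i)) (α<b i) }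

  -- Below degree `d` the coefficient `f` is brought to its normal form in the smaller quotient;
  -- otherwise a division step lowers the power of x₁. That step turns `f` into `f *ₚ c j`, so the
  -- induction hypothesis must cover every `f`.
  spanned-prepend : ∀ a → (∀ {a′} → a′ < a → ∀ f → Spanned⁺ (prepend a′ f)) → ∀ f → Spanned⁺ (prepend a f)
  spanned-prepend a IH f with a ℕ.<? d
  ... | yes a<d = let t , f∼t = spanned f in
    List.map (λ (e , α) → e , a<d ∷ᵇ α) t ,
    ∼-trans (prepend-congruent a f∼t) (≈⇒∼ (P⁺.reflexive (trans (sym (List.map-∘ t)) (List.map-∘ t))))
  ... | no a≮d = subst (λ e → Spanned⁺ (prepend e f)) (restore a≮d)
    (spanned-resp (reduce (a ∸ d) f) (spanned-neg (spanned-∑ₚ _ λ j → IH (descends a≮d j) (f *ₚ c j))))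

  spanned⁺ : ∀ f → Spanned⁺ f
  spanned⁺ []                = spanned-0
  spanned⁺ ((e , a ∷ α) ∷ f) = spanned-+
    (WF.All.wfRec <-wellFounded 0ℓ (λ a → ∀ f → Spanned⁺ (prepend a f)) spanned-prepend a ((e , α) ∷ []))
    (spanned⁺ f)

  -- Independence: extending the functionals by a recurrence

  module _ (γ₀ : ℕ) (γ : Exponents n) where

    private
      -- Only the exponent of x₁ is compared, because the recurrence lets the remaining exponents
      -- grow.
      _≺_ : Exponents (suc n) → Exponents (suc n) → Set
      _≺_ = _<_ on Vec.head

      ≺-wellFounded : WellFounded _≺_
      ≺-wellFounded = On.wellFounded Vec.head <-wellFounded

      indicator : ℕ → ℤ
      indicator a = if does (a ℕ.≟ γ₀) then 1ℤ else 0ℤ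

      -- The prescribed slices: `dual γ` on the slice x₁^γ₀ and zero on the others.
      initial : ℕ → Exponents n → ℤ
      initial a α = indicator a ℤ.* dual γ α

      -- For `a` at least `d` the value is forced: the functional has to vanish on x₁^(a-d)·x^α
      -- times the monic polynomial. Negation is written as multiplication by `-1ℤ` so that
      -- `eval-scale` applies.
      step : ∀ α → WfRec _≺_ (λ _ → ℤ) α → ℤ
      step (a ∷ α) Φ with a ℕ.<? d
      ... | yes _  = initial a α
      ... | no a≮d = -1ℤ ℤ.* ∑ (λ j → eval (λ β → Φ {a ∸ d ℕ.+ toℕ j ∷ α ⊕ β} (descends a≮d j)) (c j))

      -- Extensionality of the recursion step, which unfolding the well-founded fixed point demands.
      step-ext : ∀ α {Φ Φ′ : WfRec _≺_ (λ _ → ℤ) α} →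
                 (∀ {β} β≺α → Φ {β} β≺α ≡ Φ′ {β} β≺α) →
                 step α (λ {β} → Φ {β}) ≡ step α (λ {β} → Φ′ {β})
      step-ext (a ∷ α) Φ≡Φ′ with a ℕ.<? d
      ... | yes _  = refl
      ... | no a≮d = cong (-1ℤ ℤ.*_) (Sumℤ.sum-cong-≗ λ j →
        eval-cong (λ β → Φ≡Φ′ {a ∸ d ℕ.+ toℕ j ∷ α ⊕ β} (descends a≮d j)) (c j))

    dual⁺ : Exponents (suc n) → ℤ
    dual⁺ = WF.All.wfRec ≺-wellFounded 0ℓ (λ _ → ℤ) step

    private
      unfold : ∀ α → dual⁺ α ≡ step α (λ {β} _ → dual⁺ β)
      unfold α = WF.FixPoint.unfold-wfRec ≺-wellFounded (λ _ → ℤ) step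
        (λ β {Φ} {Φ′} Φ≡Φ′ → step-ext β {λ {γ} → Φ {γ}} {λ {γ} → Φ′ {γ}} (λ {γ} → Φ≡Φ′ {γ})) {α}

    dual⁺-initial : ∀ {a} → a < d → ∀ α → dual⁺ (a ∷ α) ≡ initial a α
    dual⁺-initial {a} a<d α = trans (unfold (a ∷ α)) lemma
      where
      lemma : step (a ∷ α) (λ {β} _ → dual⁺ β) ≡ initial a α
      lemma with a ℕ.<? d
      ... | yes _  = refl
      ... | no a≮d = contradiction a<d a≮d

    dual⁺-recurrence : ∀ a α → dual⁺ (a ℕ.+ d ∷ α) ≡
                       -1ℤ ℤ.* ∑ (λ j → eval (λ β → dual⁺ (a ℕ.+ toℕ j ∷ α ⊕ β)) (c j))
    dual⁺-recurrence a α = trans (unfold (a ℕ.+ d ∷ α)) lemma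
      where
      lemma : step (a ℕ.+ d ∷ α) (λ {β} _ → dual⁺ β) ≡
              -1ℤ ℤ.* ∑ (λ j → eval (λ β → dual⁺ (a ℕ.+ toℕ j ∷ α ⊕ β)) (c j))
      lemma with a ℕ.+ d ℕ.<? d
      ... | yes a+d<d = contradiction a+d<d (ℕ.m+n≮n a d)
      ... | no _ = cong (λ e → -1ℤ ℤ.* ∑ (λ j → eval (λ β → dual⁺ (e ℕ.+ toℕ j ∷ α ⊕ β)) (c j))) (ℕ.m+n∸n≡m a d)

    -- A slice below `d` is a multiple of `dual γ`. A later slice is a combination of earlier ones,
    -- each composed with multiplication by some `c j`, and such multiplication preserves the
    -- smaller ideal.
    slices-annihilate : ∀ a → (∀ {a′} → a′ < a → Annihilates (λ α → dual⁺ (a′ ∷ α)) g) →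
                        Annihilates (λ α → dual⁺ (a ∷ α)) g
    slices-annihilate a IH i α = split (a ℕ.<? d)
      where
      -- Moves the exponent from `c j` next to `α`, so that the induction hypothesis applies at
      -- `α ⊕ β′`.
      swap : ∀ β β′ → (α ⊕ β) ⊕ β′ ≡ (α ⊕ β′) ⊕ β
      swap β β′ = trans (⊕-assoc α β β′) (trans (cong (α ⊕_) (⊕-comm β β′)) (sym (⊕-assoc α β′ β)))
      split : Dec (a < d) → eval (λ β → dual⁺ (a ∷ α ⊕ β)) (g i) ≡ 0ℤ
      split (yes a<d) = begin
        eval (λ β → dual⁺ (a ∷ α ⊕ β)) (g i)
          ≡⟨ eval-cong (λ β → dual⁺-initial a<d (α ⊕ β)) (g i) ⟩
        eval (λ β → initial a (α ⊕ β)) (g i)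
          ≡⟨ eval-scale (indicator a) (λ β → dual γ (α ⊕ β)) (g i) ⟩
        indicator a ℤ.* eval (λ β → dual γ (α ⊕ β)) (g i)
          ≡⟨ cong (ℤ._*_ (indicator a)) (dual-annihilates γ i α) ⟩
        indicator a ℤ.* 0ℤ
          ≡⟨ ℤ.*-zeroʳ (indicator a) ⟩
        0ℤ ∎
      split (no a≮d) = begin
        eval (λ β → dual⁺ (a ∷ α ⊕ β)) (g i)
          ≡⟨ eval-cong (λ β → trans (cong (λ e → dual⁺ (e ∷ α ⊕ β)) (sym (restore a≮d)))
                                    (dual⁺-recurrence (a ∸ d) (α ⊕ β))) (g i) ⟩
        eval (λ β → -1ℤ ℤ.* ∑ (λ j → eval (λ β′ → dual⁺ (a ∸ d ℕ.+ toℕ j ∷ (α ⊕ β) ⊕ β′)) (c j))) (g i)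
          ≡⟨ eval-scale -1ℤ _ (g i) ⟩
        -1ℤ ℤ.* eval (λ β → ∑ (λ j → eval (λ β′ → dual⁺ (a ∸ d ℕ.+ toℕ j ∷ (α ⊕ β) ⊕ β′)) (c j))) (g i)
          ≡⟨ cong (-1ℤ ℤ.*_) (trans
               (eval-∑ (λ j β → eval (λ β′ → dual⁺ (a ∸ d ℕ.+ toℕ j ∷ (α ⊕ β) ⊕ β′)) (c j)) (g i))
               (∑-zero vanish)) ⟩
        0ℤ ∎
        where
          vanish : ∀ j → eval (λ β → eval (λ β′ → dual⁺ (a ∸ d ℕ.+ toℕ j ∷ (α ⊕ β) ⊕ β′)) (c j)) (g i) ≡ 0ℤ
          vanish j = begin
            eval (λ β → eval (λ β′ → dual⁺ (a ∸ d ℕ.+ toℕ j ∷ (α ⊕ β) ⊕ β′)) (c j)) (g i)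
              ≡⟨ eval-swap _ (g i) (c j) ⟩
            eval (λ β′ → eval (λ β → dual⁺ (a ∸ d ℕ.+ toℕ j ∷ (α ⊕ β) ⊕ β′)) (g i)) (c j)
              ≡⟨ eval-cong (λ β′ → trans
                   (eval-cong (λ β → cong (λ ε → dual⁺ (a ∸ d ℕ.+ toℕ j ∷ ε)) (swap β β′)) (g i))
                   (IH (descends a≮d j) i (α ⊕ β′))) (c j) ⟩
            eval (λ _ → 0ℤ) (c j)
              ≡⟨ eval-zero (c j) ⟩
            0ℤ ∎

    -- On multiples of the monic generator the recurrence cancels the leading term against the rest;
    -- on multiples of an old generator only a single slice is involved.
    dual⁺-annihilates : Annihilates dual⁺ g⁺
    dual⁺-annihilates zero (a ∷ α) = begin
      eval (λ β → dual⁺ ((a ∷ α) ⊕ β)) (g⁺ zero)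
        ≡⟨ eval-resp-≈ₚ _ g-head ⟩
      eval (λ β → dual⁺ ((a ∷ α) ⊕ β)) (monic c)
        ≡⟨ eval-monic c (λ β → dual⁺ ((a ∷ α) ⊕ β)) ⟩
      s ℤ.+ dual⁺ (a ℕ.+ d ∷ α ⊕ replicate n 0)
        ≡⟨ cong (λ ε → s ℤ.+ dual⁺ (a ℕ.+ d ∷ ε)) (Vec.zipWith-identityʳ ℕ.+-identityʳ α) ⟩
      s ℤ.+ dual⁺ (a ℕ.+ d ∷ α)
        ≡⟨ cong (ℤ._+_ s) (trans (dual⁺-recurrence a α) (ℤ.-1*i≡-i s)) ⟩
      s ℤ.- s
        ≡⟨ ℤ.+-inverseʳ s ⟩
      0ℤ ∎
      where s = ∑ (λ j → eval (λ β → dual⁺ (a ℕ.+ toℕ j ∷ α ⊕ β)) (c j))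
    dual⁺-annihilates (suc i) (a ∷ α) = begin
      eval (λ β → dual⁺ ((a ∷ α) ⊕ β)) (g⁺ (suc i))
        ≡⟨ cong (eval (λ β → dual⁺ ((a ∷ α) ⊕ β))) (g-tail i) ⟩
      eval (λ β → dual⁺ ((a ∷ α) ⊕ β)) (prepend 0 (g i))
        ≡⟨ eval-prepend (λ β → dual⁺ ((a ∷ α) ⊕ β)) 0 (g i) ⟩
      eval (λ β → dual⁺ (a ℕ.+ 0 ∷ α ⊕ β)) (g i)
        ≡⟨ WF.All.wfRec <-wellFounded 0ℓ
             (λ a → Annihilates (λ α → dual⁺ (a ∷ α)) g) slices-annihilate (a ℕ.+ 0) i α ⟩
      0ℤ ∎

    dual⁺≡δ : ∀ α → (∀ i → lookup α i < b⁺ i) → dual⁺ α ≡ δ (γ₀ ∷ γ) α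
    dual⁺≡δ (a ∷ α) α<b = begin
      dual⁺ (a ∷ α)
        ≡⟨ dual⁺-initial (α<b zero) α ⟩
      initial a α
        ≡⟨ cong (ℤ._*_ (indicator a)) (dual≡δ γ α (λ i → subst (lookup α i <_) (b-tail i) (α<b (suc i)))) ⟩
      indicator a ℤ.* δ γ α
        -- Deciding equality of two nonempty vectors computes to the conjunction of the tests on
        -- heads and tails.
        ≡⟨ indicator-∧ (does (a ℕ.≟ γ₀)) (does (α ≟ᴱ γ)) ⟩
      δ (γ₀ ∷ γ) (a ∷ α) ∎
      where
      indicator-∧ : ∀ p q → (if p then 1ℤ else 0ℤ) ℤ.* (if q then 1ℤ else 0ℤ) ≡ (if p ∧ q then 1ℤ else 0ℤ)
      indicator-∧ true  q = ℤ.*-identityˡ _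
      indicator-∧ false q = refl

  normalForms : NormalForms g⁺ b⁺
  normalForms = record
    { spanned          = spanned⁺
    ; dual             = λ { (γ₀ ∷ γ) → dual⁺ γ₀ γ }
    ; dual-annihilates = λ { (γ₀ ∷ γ) → dual⁺-annihilates γ₀ γ }
    ; dual≡δ           = λ { (γ₀ ∷ γ) → dual⁺≡δ γ₀ γ }
    }

-- Complete homogeneous polynomials

exponentsOfDegree-0 : (S : Subset n) → exponentsOfDegree S 0 ≡ replicate n 0 ∷ []
exponentsOfDegree-0 []            = refl
exponentsOfDegree-0 (outside ∷ S) = cong (List.map (0 ∷_)) (exponentsOfDegree-0 S)
exponentsOfDegree-0 (inside  ∷ S) =
  trans (List.++-identityʳ _) (cong (List.map (0 ∷_)) (exponentsOfDegree-0 S))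

ẽ-outside : (r : ℕ) (S : Subset n) → ẽ r (outside ∷ S) ≡ prepend 0 (ẽ r S)
ẽ-outside r S = trans (sym (List.map-∘ (exponentsOfDegree S r))) (List.map-∘ (exponentsOfDegree S r))

-- Sort the monomials by their power of x₁: the coefficient of x₁^j is the complete homogeneous
-- polynomial of degree r-j in the other variables, which for j = r is 1.
ẽ-inside : (r : ℕ) (S : Subset n) → ẽ r (inside ∷ S) ≈ₚ monic {d = r} (λ j → ẽ (r ∸ toℕ j) S)
ẽ-inside {n} r S = ≈ₚ-by-eval λ φ → begin
  eval φ (ẽ r (inside ∷ S))
    ≡⟨ concat φ (λ a → a) (suc r) ⟩
  ∑ {suc r} (λ j → eval (λ α → φ (toℕ j ∷ α)) (ẽ (r ∸ toℕ j) S))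
    ≡⟨ Sumℤ.sum-init-last {r} (λ j → eval (λ α → φ (toℕ j ∷ α)) (ẽ (r ∸ toℕ j) S)) ⟩
  ∑ {r} (λ j → eval (λ α → φ (toℕ (Fin.inject₁ j) ∷ α)) (ẽ (r ∸ toℕ (Fin.inject₁ j)) S))
    ℤ.+ eval (λ α → φ (toℕ (Fin.fromℕ r) ∷ α)) (ẽ (r ∸ toℕ (Fin.fromℕ r)) S)
    ≡⟨ cong₂ ℤ._+_
         (Sumℤ.sum-cong-≗ {r} λ j → cong (λ a → eval (λ α → φ (a ∷ α)) (ẽ (r ∸ a) S)) (Fin.toℕ-inject₁ j))
         (trans (cong (λ a → eval (λ α → φ (a ∷ α)) (ẽ (r ∸ a) S)) (Fin.toℕ-fromℕ r)) (leading φ)) ⟩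
  ∑ {r} (λ j → eval (λ α → φ (toℕ j ∷ α)) (ẽ (r ∸ toℕ j) S)) ℤ.+ φ (r ∷ replicate n 0)
    ≡⟨ eval-monic {d = r} _ φ ⟨
  eval φ (monic {d = r} (λ j → ẽ (r ∸ toℕ j) S)) ∎
  where
  -- `upTo` is generalised to `applyUpTo e`, since its tail is enumerated by `e ∘ suc`.
  concat : ∀ φ (e : ℕ → ℕ) m →
    eval φ (List.map (1ℤ ,_) (concatMap (λ a → List.map (a ∷_) (exponentsOfDegree S (r ∸ a))) (applyUpTo e m)))
      ≡ ∑ {m} (λ j → eval (λ α → φ (e (toℕ j) ∷ α)) (ẽ (r ∸ e (toℕ j)) S))
  concat φ e zero    = refl
  concat φ e (suc m) = begin
    eval φ (List.map (1ℤ ,_) (List.map (e 0 ∷_) E ++ rest))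
      ≡⟨ cong (eval φ) (List.map-++ (1ℤ ,_) (List.map (e 0 ∷_) E) rest) ⟩
    eval φ (List.map (1ℤ ,_) (List.map (e 0 ∷_) E) ++ List.map (1ℤ ,_) rest)
      ≡⟨ eval-++ φ (List.map (1ℤ ,_) (List.map (e 0 ∷_) E)) _ ⟩
    eval φ (List.map (1ℤ ,_) (List.map (e 0 ∷_) E)) ℤ.+ eval φ (List.map (1ℤ ,_) rest)
      ≡⟨ cong₂ ℤ._+_
           (trans (cong (eval φ) (trans (sym (List.map-∘ E)) (List.map-∘ E)))
                  (eval-prepend φ (e 0) (List.map (1ℤ ,_) E)))
           (concat φ (e ∘ suc) m) ⟩
    ∑ {suc m} (λ j → eval (λ α → φ (e (toℕ j) ∷ α)) (ẽ (r ∸ e (toℕ j)) S)) ∎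
    where
    E = exponentsOfDegree S (r ∸ e 0)
    rest = concatMap (λ a → List.map (a ∷_) (exponentsOfDegree S (r ∸ a))) (applyUpTo (e ∘ suc) m)
  leading : ∀ φ → eval (λ α → φ (r ∷ α)) (ẽ (r ∸ r) S) ≡ φ (r ∷ replicate n 0)
  leading φ = begin
    eval (λ α → φ (r ∷ α)) (ẽ (r ∸ r) S)
      ≡⟨ cong (λ m → eval (λ α → φ (r ∷ α)) (ẽ m S)) (ℕ.n∸n≡0 r) ⟩
    eval (λ α → φ (r ∷ α)) (ẽ 0 S)
      ≡⟨ cong (λ E → eval (λ α → φ (r ∷ α)) (List.map (1ℤ ,_) E)) (exponentsOfDegree-0 S) ⟩
    eval (λ α → φ (r ∷ α)) 1ₚ
      ≡⟨ trans (ℤ.+-identityʳ _) (ℤ.*-identityˡ _) ⟩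
    φ (r ∷ replicate n 0) ∎

-- Induction on the number of variables

variablesFrom-suc : (i : Fin n) → variablesFrom (suc i) ≡ outside ∷ variablesFrom i
variablesFrom-suc i = cong (outside ∷_) (Vec.tabulate-cong (≤?-suc i))
  where
  ≤?-suc : ∀ {m} (i j : Fin m) → does (suc i Fin.≤? suc j) ≡ does (i Fin.≤? j)
  ≤?-suc zero    j = refl
  ≤?-suc (suc i) j = refl

-- The induction passes to `b ∘ suc`, whose first value can be 2 even when `b` is a degree function,
-- so the claim ranges over all `b`.
homogeneous-normalForms : (b : Fin n → ℕ) → NormalForms (λ i → ẽ (b i) (variablesFrom i)) b
homogeneous-normalForms {zero} b = record
  { spanned          = λ f → List.map (λ (c , _) → c , bounded [] (λ ())) f ,
                       ≈⇒congruent (ℤ[x] 0) (λ i → ẽ (b i) (variablesFrom i))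
                         (≈ₚ-by-eval (λ φ → flat φ f))
  -- Without variables the ring is ℤ and there are no generators; the functional adds up the
  -- coefficients of the only monomial.
  ; dual             = λ _ _ → 1ℤ
  ; dual-annihilates = λ _ ()
  ; dual≡δ           = λ { [] [] _ → refl }
  }
  where
  flat : ∀ φ (f : Poly 0) → eval φ f ≡ eval φ (toPoly {b = b} (List.map (λ (c , _) → c , bounded [] (λ ())) f))
  flat φ []             = refl
  flat φ ((c , []) ∷ f) = cong (ℤ._+_ (c ℤ.* φ [])) (flat φ f)
homogeneous-normalForms {suc n} b = Extension.normalForms (homogeneous-normalForms (b ∘ suc))
  (λ _ → refl)
  -- `variablesFrom zero` is the full set of variables, so its tail is full as well.
  (λ j → ẽ (b zero ∸ toℕ j) (Vec.tabulate (λ _ → inside)))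
  (ẽ-inside (b zero) (Vec.tabulate (λ _ → inside)))
  (λ i → trans (cong (ẽ (b (suc i))) (variablesFrom-suc i)) (ẽ-outside (b (suc i)) (variablesFrom i)))

mainTheorem10 : (n : ℕ) (h : Fin n → Fin n) → IsHessenberg h →
    IsBasis (quotientModule (generators h)) (𝓑 h)
mainTheorem10 n h _ = NormalForms⇒IsBasis {g = generators h} {b = degree h}
  (homogeneous-normalForms (degree h))
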